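{- Let $\pi\in S_n$ and $i,j\in\{1,2,\dots,n\}$. Then the edge $bi$ crosses the edge $aj$ in the geometric graph $\overline{K}_{2,n}(\pi)$ if and only if $(i,j)\in E(\pi)$.
   Context: A geometric graph is a simple graph together with a straight-line drawing in the plane with vertices in general position (no three vertices collinear, no three edges crossing at a single point). Two edges cross if they meet at a point interior to both. The vertex set of $K_{2,n}$ is $\{a,b\}\cup\{1,\dots,n\}$, with $a$ and $b$ each adjacent to all of $1,\dots,n$. For $\pi\in S_n$, the realization $\overline{K}_{2,n}(\pi)$ is built as follows. From each of two points $a,b\in\mathbb{R}^2$ draw $n$ rays, all on the same side of the line $ab$, such that each ray from $a$ meets each ray from $b$ (and generic, so that general position holds below). Label the rays from $b$ as $1,\dots,n$ in increasing order of the angle they make with the segment $ba$; label the rays from $a$ as $\pi(1),\dots,\pi(n)$ in increasing order of the angle they make with the segment $ab$. Place vertex $i$ at the intersection of the ray from $a$ labeled $i$ and the ray from $b$ labeled $i$, and draw the segments $ai$, $bi$ for all $i$. The inversion set of $\pi$ is $E(\pi)=\{(i,j): 1\le i<j\le n,\ \pi^{ -1}(i)>\pi^{ -1}(j)\}$. -}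

module Defs where

open import Algebra.Apartness.Bundles using (HeytingField)
open import Data.Empty using (⊥)
open import Data.Fin.Base as Fin using (Fin)
open import Data.Fin.Permutation using (Permutation′; _⟨$⟩ʳ_; _⟨$⟩ˡ_)
open import Data.Nat.Base using (ℕ)
open import Data.Product.Base using (_×_; _,_; ∃-syntax)
open import Data.Sum.Base using (_⊎_)
open import Data.Unit.Base using (⊤; tt)
open import Function.Bundles using (_⇔_)
open import Level using (Level; 0ℓ; suc; _⊔_)
open import Relation.Binary.Core using (Rel)
open import Relation.Binary.Definitions using (Symmetric; Irreflexive)
open import Relation.Binary.PropositionalEquality.Core using (_≡_; _≢_)
open import Relation.Binary.Structures using (IsStrictPartialOrder)
open import Relation.Nullary.Negation.Core using (¬_)
open import Relation.Unary using (Pred)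

-- The standard library has no real numbers, so the plane is taken over an
-- arbitrary ordered field, ℝ being the intended instance.  Apartness is the
-- constructive form of ≢; over the classical ℝ it is ≢, and #⇔<⊎> is then
-- trichotomy.

record OrderedField c ℓ₁ ℓ₂ : Set (suc (c ⊔ ℓ₁ ⊔ ℓ₂)) where
  infix 4 _<_ _≤_
  field
    heytingField : HeytingField c ℓ₁ ℓ₂

  open HeytingField heytingField public

  field
    _<_                  : Rel Carrier ℓ₂
    isStrictPartialOrder : IsStrictPartialOrder _≈_ _<_
    #⇔<⊎>                : ∀ {x y} → x # y ⇔ (x < y ⊎ y < x)
    +-monoˡ-<            : ∀ {x y} z → x < y → x + z < y + z
    *-pos                : ∀ {x y} → 0# < x → 0# < y → 0# < x * y

  _≤_ : Rel Carrier ℓ₂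
  x ≤ y = ¬ (y < x)

record SimpleGraph : Set₁ where
  field
    Vertex     : Set
    Adj        : Rel Vertex 0ℓ
    adj-sym    : Symmetric Adj
    adj-irrefl : Irreflexive _≡_ Adj

record Edge (G : SimpleGraph) : Set where
  constructor edge
  open SimpleGraph G
  field
    source target : Vertex
    adjacent      : Adj source target

module _ {G : SimpleGraph} where
  open Edge

  -- Edges are undirected.
  SameEdge : Rel (Edge G) 0ℓ
  SameEdge e f = (source e ≡ source f × target e ≡ target f)
               ⊎ (source e ≡ target f × target e ≡ source f)

data Vertex₂ (n : ℕ) : Set where
  a b : Vertex₂ n
  ⟨_⟩ : Fin n → Vertex₂ n

Adj₂ : ∀ {n} → Rel (Vertex₂ n) 0ℓ
Adj₂ a     ⟨ _ ⟩ = ⊤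
Adj₂ b     ⟨ _ ⟩ = ⊤
Adj₂ ⟨ _ ⟩ a     = ⊤
Adj₂ ⟨ _ ⟩ b     = ⊤
Adj₂ _     _     = ⊥

K₂ : ℕ → SimpleGraph
K₂ n = record
  { Vertex     = Vertex₂ n
  ; Adj        = Adj₂
  ; adj-sym    = λ {u} {v} → sym₂ u v
  ; adj-irrefl = λ {u} → irrefl₂ u
  }
  where
  sym₂ : ∀ u v → Adj₂ {n} u v → Adj₂ v u
  sym₂ a     ⟨ _ ⟩ _ = tt
  sym₂ b     ⟨ _ ⟩ _ = tt
  sym₂ ⟨ _ ⟩ a     _ = tt
  sym₂ ⟨ _ ⟩ b     _ = tt

  irrefl₂ : ∀ u {v} → u ≡ v → ¬ Adj₂ {n} u v
  irrefl₂ a     _≡_.refl ()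
  irrefl₂ b     _≡_.refl ()
  irrefl₂ ⟨ _ ⟩ _≡_.refl ()

edge-a edge-b : ∀ {n} → Fin n → Edge (K₂ n)
edge-a i = edge a ⟨ i ⟩ tt
edge-b i = edge b ⟨ i ⟩ tt

E : ∀ {n} → Permutation′ n → Pred (Fin n × Fin n) 0ℓ
E π (i , j) = i Fin.< j × π ⟨$⟩ˡ i Fin.> π ⟨$⟩ˡ j

module Plane {c ℓ₁ ℓ₂ : Level} (F : OrderedField c ℓ₁ ℓ₂) where
  open OrderedField F

  infix  4 _≈ₚ_
  infixl 6 _+ₚ_ _-ₚ_
  infixl 7 _·_

  Point : Set c
  Point = Carrier × Carrier

  _≈ₚ_ : Rel Point ℓ₁
  (x , y) ≈ₚ (x′ , y′) = x ≈ x′ × y ≈ y′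

  _+ₚ_ _-ₚ_ : Point → Point → Point
  (x , y) +ₚ (x′ , y′) = x + x′ , y + y′
  (x , y) -ₚ (x′ , y′) = x - x′ , y - y′

  _·_ : Carrier → Point → Point
  t · (x , y) = t * x , t * y

  det : Point → Point → Carrier
  det (x , y) (x′ , y′) = x * y′ - y * x′

  Collinear : Point → Point → Point → Set ℓ₁
  Collinear p q r = det (q -ₚ p) (r -ₚ p) ≈ 0#

  InteriorOfSegment : Point → Point → Point → Set (c ⊔ ℓ₁ ⊔ ℓ₂)
  InteriorOfSegment p q z =
    ∃[ t ] 0# < t × t < 1# × z ≈ₚ p +ₚ t · (q -ₚ p)

  -- z lies on the ray from o through p.
  OnRay : Point → Point → Point → Set (c ⊔ ℓ₁ ⊔ ℓ₂)
  OnRay o p z = ∃[ t ] 0# ≤ t × z ≈ₚ o +ₚ t · (p -ₚ o)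

  LeftOf RightOf : Point → Point → Point → Set ℓ₂
  LeftOf  p q z = 0# < det (q -ₚ p) (z -ₚ p)
  RightOf p q z = det (q -ₚ p) (z -ₚ p) < 0#

  -- ∠ p o q < ∠ p o r for q and r on the same side of the line op: the ray
  -- oq runs strictly inside the angle ∠ p o r, that is, q - o is a positive
  -- combination of p - o and r - o.
  SmallerAngle : (p o q r : Point) → Set (c ⊔ ℓ₁ ⊔ ℓ₂)
  SmallerAngle p o q r = ∃[ α ] ∃[ β ] 0# < α × 0# < β ×
    q -ₚ o ≈ₚ α · (p -ₚ o) +ₚ β · (r -ₚ o)

  record GeometricGraph (G : SimpleGraph) : Set (c ⊔ ℓ₁ ⊔ ℓ₂) where
    open SimpleGraph G
    field
      position : Vertex → Point

    InteriorOfEdge : Edge G → Point → Set (c ⊔ ℓ₁ ⊔ ℓ₂)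
    InteriorOfEdge e =
      InteriorOfSegment (position (Edge.source e)) (position (Edge.target e))

    Crosses : Rel (Edge G) (c ⊔ ℓ₁ ⊔ ℓ₂)
    Crosses e f = ∃[ z ] InteriorOfEdge e z × InteriorOfEdge f z

    field
      distinct : ∀ {u v} → u ≢ v → ¬ (position u ≈ₚ position v)

      noThreeCollinear : ∀ {u v w} → u ≢ v → u ≢ w → v ≢ w →
        ¬ Collinear (position u) (position v) (position w)

      noThreeConcurrent : ∀ {e f g} →
        ¬ SameEdge e f → ¬ SameEdge e g → ¬ SameEdge f g →
        ¬ (∃[ z ] InteriorOfEdge e z × InteriorOfEdge f z × InteriorOfEdge g z)

  -- A geometric graph obtained by the ray construction of K̄₂,ₙ(π).  The k-th
  -- ray from a (by angle) goes through rayA k and carries the label π(k); the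
  -- k-th ray from b goes through rayB k and carries the label k.
  record Realization {n : ℕ} (π : Permutation′ n) : Set (c ⊔ ℓ₁ ⊔ ℓ₂) where
    field
      geometricGraph : GeometricGraph (K₂ n)

    open GeometricGraph geometricGraph public

    A : Point
    A = position a

    B : Point
    B = position b

    field
      rayA rayB : Fin n → Point

      sameSide : (∀ k → LeftOf  A B (rayA k) × LeftOf  A B (rayB k))
               ⊎ (∀ k → RightOf A B (rayA k) × RightOf A B (rayB k))

      raysMeet : ∀ k l → ∃[ z ] OnRay A (rayA k) z × OnRay B (rayB l) z

      increasingA : ∀ {k l} → k Fin.< l → SmallerAngle B A (rayA k) (rayA l)
      increasingB : ∀ {k l} → k Fin.< l → SmallerAngle A B (rayB k) (rayB l)

      vertexOnRayA : ∀ k → OnRay A (rayA k) (position ⟨ π ⟨$⟩ʳ k ⟩)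
      vertexOnRayB : ∀ k → OnRay B (rayB k) (position ⟨ k ⟩)

{-# OPTIONS --safe #-}
module Submission where

-- Let σ = ±1 be the side of AB carrying the rays and [u , v] = σ det(u , v).
-- For vertices P = i and Q = j, the lines BP and AQ meet at B + s(P - B) =
-- A + t(Q - A), where by Cramer's rule, with Δ = [Q - A , P - B],
-- tΔ = [B - A , P - A] and sΔ = [B - A , Q - A], both positive.  Moreover
-- Δ - tΔ = [Q - B , P - B] and Δ - sΔ = [Q - A , P - A].  So the segments cross
-- iff the last two brackets are positive, and these compare the angles at b
-- and at a, that is, i with j and π⁻¹(j) with π⁻¹(i).

open import Defs
open import Data.Fin.Base using (Fin)
open import Data.Fin.Permutation using (Permutation′)
open import Data.Nat.Base using (ℕ)
open import Data.Product.Base using (_,_)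
open import Function.Bundles using (_⇔_)
open import Level using (Level)
open import Relation.Unary using (_∈_)

open import Algebra.Bundles using (CommutativeRing)
open import Algebra.Apartness.Bundles using (HeytingCommutativeRing)
import Algebra.Apartness.Properties.HeytingCommutativeRing as HeytingProperties
import Algebra.Properties.Ring as RingProperties
import Algebra.Properties.Semiring.Mult as Mult
import Algebra.Solver.Ring as RingSolver
open import Algebra.Solver.Ring.AlmostCommutativeRing
  using (fromCommutativeRing; _-Raw-AlmostCommutative⟶_)
open import Data.Empty using (⊥-elim)
import Data.Fin.Base as Fin
import Data.Fin.Properties as Fin
open import Data.Fin.Permutation using (_⟨$⟩ʳ_; _⟨$⟩ˡ_; inverseʳ)
open import Data.Integer.Base as ℤ using (ℤ; +_; -[1+_]; _⊖_)
import Data.Integer.Properties as ℤ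
open import Data.Maybe.Base using (map)
open import Data.Nat.Base as ℕ using (zero; suc)
open import Data.Product.Base using (_×_; ∃-syntax; proj₁; proj₂)
open import Data.Sum.Base using (inj₁; inj₂)
open import Function.Base using (_$_)
open import Function.Bundles using (mk⇔; Equivalence)
open import Relation.Binary.Definitions using (tri<; tri≈; tri>)
open import Relation.Binary.PropositionalEquality.Core as ≡ using (_≡_)
open import Relation.Binary.Structures using (IsStrictPartialOrder)
import Relation.Binary.Reasoning.Setoid as SetoidReasoning
open import Relation.Nullary.Decidable.Core using (dec⇒maybe)
open import Relation.Nullary.Negation.Core using (¬_)

-- Integers inside a commutative ring.

-- Integer coefficients let the ring solver see cancellations, which are not
-- decidable in the carrier itself.
module IntegerCoefficients {c ℓ} (R : CommutativeRing c ℓ) where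
  open CommutativeRing R
  open RingProperties ring
  open Mult semiring renaming (_×_ to _⨯_)
  open SetoidReasoning setoid

  fromℤ : ℤ → Carrier
  fromℤ (+ n)    = n ⨯ 1#
  fromℤ -[1+ n ] = - (suc n ⨯ 1#)

  -- `_⊖_` strips a successor from both arguments at once, so the induction inserts `1# - 1#` and
  -- hands one half to each multiple.
  fromℤ-⊖ : ∀ m n → fromℤ (m ⊖ n) ≈ m ⨯ 1# - n ⨯ 1#
  fromℤ-⊖ zero    zero    = sym (-‿inverseʳ 0#)
  fromℤ-⊖ zero    (suc n) = sym (+-identityˡ _)
  fromℤ-⊖ (suc m) zero    = sym (trans (+-congˡ -0#≈0#) (+-identityʳ _))
  fromℤ-⊖ (suc m) (suc n) = begin
    fromℤ (suc m ⊖ suc n)         ≡⟨ ≡.cong fromℤ (ℤ.[1+m]⊖[1+n]≡m⊖n m n) ⟩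
    fromℤ (m ⊖ n)                 ≈⟨ fromℤ-⊖ m n ⟩
    x - y                         ≈⟨ +-congˡ (+-identityˡ (- y)) ⟨
    x + (0# - y)                  ≈⟨ +-congˡ (+-congʳ (-‿inverseʳ 1#)) ⟨
    x + (1# - 1# - y)             ≈⟨ +-congˡ (+-assoc 1# (- 1#) (- y)) ⟩
    x + (1# + (- 1# - y))         ≈⟨ +-assoc x 1# _ ⟨
    x + 1# + (- 1# - y)           ≈⟨ +-cong (+-comm x 1#) (-‿+-comm 1# y) ⟩
    1# + x - (1# + y)             ∎
    where x = m ⨯ 1#; y = n ⨯ 1#

  fromℤ-neg : ∀ i → fromℤ (ℤ.- i) ≈ - fromℤ i
  fromℤ-neg (+ zero)  = sym -0#≈0#
  fromℤ-neg (+ suc n) = refl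
  fromℤ-neg -[1+ n ]  = sym (-‿involutive _)

  fromℤ-+ : ∀ i j → fromℤ (i ℤ.+ j) ≈ fromℤ i + fromℤ j
  fromℤ-+ (+ m)    (+ n)    = ×-homo-+ 1# m n
  fromℤ-+ (+ m)    -[1+ n ] = fromℤ-⊖ m (suc n)
  fromℤ-+ -[1+ m ] (+ n)    = trans (fromℤ-⊖ n (suc m)) (+-comm _ _)
  fromℤ-+ -[1+ m ] -[1+ n ] = begin
    fromℤ (-[1+ m ] ℤ.+ -[1+ n ])     ≡⟨ ≡.cong fromℤ (ℤ.neg-distrib-+ (+ suc m) (+ suc n)) ⟨
    - ((suc m ℕ.+ suc n) ⨯ 1#)        ≈⟨ -‿cong (×-homo-+ 1# (suc m) (suc n)) ⟩
    - (suc m ⨯ 1# + suc n ⨯ 1#)       ≈⟨ -‿+-comm _ _ ⟨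
    - (suc m ⨯ 1#) - suc n ⨯ 1#       ∎

  -- Settles the sign of the second factor; `fromℤ-*` then reduces a negative first factor to this
  -- case.
  fromℤ-*⁺ : ∀ m j → fromℤ (+ m ℤ.* j) ≈ fromℤ (+ m) * fromℤ j
  fromℤ-*⁺ m (+ n) = begin
    fromℤ (+ m ℤ.* + n)  ≡⟨ ≡.cong fromℤ (ℤ.pos-* m n) ⟨
    (m ℕ.* n) ⨯ 1#       ≈⟨ ×1-homo-* m n ⟩
    m ⨯ 1# * (n ⨯ 1#)    ∎
  fromℤ-*⁺ m -[1+ n ] = begin
    fromℤ (+ m ℤ.* -[1+ n ])       ≡⟨ ≡.cong fromℤ (ℤ.neg-distribʳ-* (+ m) (+ suc n)) ⟨
    fromℤ (ℤ.- (+ m ℤ.* + suc n))  ≈⟨ fromℤ-neg (+ m ℤ.* + suc n) ⟩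
    - fromℤ (+ m ℤ.* + suc n)      ≈⟨ -‿cong (fromℤ-*⁺ m (+ suc n)) ⟩
    - (m ⨯ 1# * (suc n ⨯ 1#))      ≈⟨ -‿distribʳ-* _ _ ⟩
    m ⨯ 1# * - (suc n ⨯ 1#)        ∎

  fromℤ-* : ∀ i j → fromℤ (i ℤ.* j) ≈ fromℤ i * fromℤ j
  fromℤ-* (+ m)    j = fromℤ-*⁺ m j
  fromℤ-* -[1+ m ] j = begin
    fromℤ (-[1+ m ] ℤ.* j)         ≡⟨ ≡.cong fromℤ (ℤ.neg-distribˡ-* (+ suc m) j) ⟨
    fromℤ (ℤ.- (+ suc m ℤ.* j))    ≈⟨ fromℤ-neg (+ suc m ℤ.* j) ⟩
    - fromℤ (+ suc m ℤ.* j)        ≈⟨ -‿cong (fromℤ-*⁺ (suc m) j) ⟩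
    - (suc m ⨯ 1# * fromℤ j)       ≈⟨ -‿distribˡ-* _ _ ⟩
    - (suc m ⨯ 1#) * fromℤ j       ∎

  homomorphism : ℤ.+-*-rawRing -Raw-AlmostCommutative⟶ fromCommutativeRing R
  homomorphism = record
    { ⟦_⟧    = fromℤ
    ; +-homo = fromℤ-+
    ; *-homo = fromℤ-*
    ; -‿homo = fromℤ-neg
    ; 0-homo = refl
    ; 1-homo = +-identityʳ 1#
    }

  module Solver = RingSolver ℤ.+-*-rawRing (fromCommutativeRing R) homomorphism
    (λ i j → map (λ i≡j → reflexive (≡.cong fromℤ i≡j)) (dec⇒maybe (i ℤ.≟ j)))

-- Signs, apartness and inverses in an ordered field.

module OrderedFieldProperties {c ℓ₁ ℓ₂} (F : OrderedField c ℓ₁ ℓ₂) where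
  open OrderedField F
  open HeytingCommutativeRing heytingCommutativeRing using (commutativeRing) public
  open HeytingProperties heytingCommutativeRing
  open IsStrictPartialOrder isStrictPartialOrder public
    using () renaming (irrefl to <-irrefl; trans to <-trans; <-respˡ-≈ to <-respˡ; <-respʳ-≈ to <-respʳ)
  open IntegerCoefficients.Solver commutativeRing public
    using (solve; _:=_; _:+_; _:*_; _:-_; :-_; con; Polynomial)
  open RingProperties (CommutativeRing.ring commutativeRing) public using (-1*x≈-x)
  open Equivalence

  x<y⇒0<y-x : ∀ {x y} → x < y → 0# < y - x
  x<y⇒0<y-x {x} x<y = <-respˡ (-‿inverseʳ x) (+-monoˡ-< (- x) x<y)

  0<y-x⇒x<y : ∀ {x y} → 0# < y - x → x < y
  0<y-x⇒x<y {x} {y} 0<y-x =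
    <-respˡ (+-identityˡ x) $
    <-respʳ (solve 2 (λ x y → y :- x :+ x := y) refl x y) $
    +-monoˡ-< x 0<y-x

  x<0⇒0<-x : ∀ {x} → x < 0# → 0# < - x
  x<0⇒0<-x {x} x<0 = <-respʳ (+-identityˡ (- x)) (x<y⇒0<y-x x<0)

  ¬0<x×0<-x : ∀ {x} → 0# < x → ¬ (0# < - x)
  ¬0<x×0<-x {x} 0<x 0<-x = <-irrefl refl $ <-trans 0<x $
    0<y-x⇒x<y (<-respʳ (sym (+-identityˡ (- x))) 0<-x)

  0<x+y : ∀ {x y} → 0# < x → 0# < y → 0# < x + y
  0<x+y {x} {y} 0<x 0<y =
    <-trans 0<y (<-respˡ (+-identityˡ y) (+-monoˡ-< y 0<x))

  -- Apartness from zero amounts to invertibility, and an inverse `z` of `x * y` yields the inverse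
  -- `z * x` of `y`.
  xy#0⇒y#0 : ∀ x y → x * y # 0# → y # 0#
  xy#0⇒y#0 x y xy#0 = let (z , z[xy-0]≈1 , _) = #⇒invertible xy#0 in
    invertibleˡ⇒# (z * x , trans
      (solve 3 (λ x y z → z :* x :* (y :- con (+ 0)) := z :* (x :* y :- con (+ 0))) refl x y z)
      z[xy-0]≈1)

  0<x⇒x#0 : ∀ {x} → 0# < x → x # 0#
  0<x⇒x#0 0<x = from #⇔<⊎> (inj₂ 0<x)

  -- Signs can be compared only after apartness from zero is known, so that comes first; a negative
  -- `y` would then make `x * y` negative.
  0<x*y⇒0<y : ∀ {x y} → 0# < x → 0# < x * y → 0# < y
  0<x*y⇒0<y {x} {y} 0<x 0<xy with to #⇔<⊎> (xy#0⇒y#0 x y (0<x⇒x#0 0<xy))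
  ... | inj₂ 0<y = 0<y
  ... | inj₁ y<0 = ⊥-elim $ ¬0<x×0<-x 0<xy $
    <-respʳ (solve 2 (λ x y → x :* :- y := :- (x :* y)) refl x y) $
    *-pos 0<x (x<0⇒0<-x y<0)

  0≤x∧x#0⇒0<x : ∀ {x} → 0# ≤ x → x # 0# → 0# < x
  0≤x∧x#0⇒0<x 0≤x x#0 with to #⇔<⊎> x#0
  ... | inj₂ 0<x = 0<x
  ... | inj₁ x<0 = ⊥-elim (0≤x x<0)

  -- Even the case `1# < 0#` proves the claim, because 1 is the square of the then positive -1.
  0<1 : 0# < 1#
  0<1 with to #⇔<⊎> 1#0
  ... | inj₂ 0<1 = 0<1
  ... | inj₁ 1<0 = <-respʳ (trans (solve 1 (λ x → :- x :* :- x := x :* x) refl 1#) (*-identityʳ 1#)) $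
    *-pos (x<0⇒0<-x 1<0) (x<0⇒0<-x 1<0)

  0<x⇒inverse : ∀ {x} → 0# < x → ∃[ y ] 0# < y × x * y ≈ 1#
  0<x⇒inverse {x} 0<x = let (y , _ , [x-0]y≈1) = #⇒invertible (0<x⇒x#0 0<x)
                            xy≈1 = trans (*-congʳ (sym (x-0≈x x))) [x-0]y≈1
    in y , 0<x*y⇒0<y 0<x (<-respʳ (sym xy≈1) 0<1) , xy≈1

-- Orientation of point triples.

module PlaneProperties {c ℓ₁ ℓ₂} (F : OrderedField c ℓ₁ ℓ₂) where
  open OrderedField F
  open OrderedFieldProperties F
  open Plane F
  open SetoidReasoning setoid

  det-cong : ∀ {p p′ q q′} → p ≈ₚ p′ → q ≈ₚ q′ → det p q ≈ det p′ q′
  det-cong (x , y) (x′ , y′) = +-cong (*-cong x y′) (-‿cong (*-cong y x′))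

  -ₚ-congˡ : ∀ {p p′} q → p ≈ₚ p′ → p -ₚ q ≈ₚ p′ -ₚ q
  -ₚ-congˡ q (x , y) = +-congʳ x , +-congʳ y

  ≈ₚ-refl : ∀ {p} → p ≈ₚ p
  ≈ₚ-refl = refl , refl

  ≈ₚ-trans : ∀ {p q r} → p ≈ₚ q → q ≈ₚ r → p ≈ₚ r
  ≈ₚ-trans (x , y) (x′ , y′) = trans x x′ , trans y y′

  ≈ₚ-sym : ∀ {p q} → p ≈ₚ q → q ≈ₚ p
  ≈ₚ-sym (x , y) = sym x , sym y

  -- With σ = ±1 this is positive exactly when r lies on a chosen side of pq.
  orient : Carrier → Point → Point → Point → Carrier
  orient σ p q r = σ * det (q -ₚ p) (r -ₚ p)

  -- Pairs of polynomials mirror the point operations, so that solver goals can be written in vector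
  -- form instead of coordinates.
  Poly² : ℕ → Set
  Poly² m = Polynomial m × Polynomial m

  infixl 7 _:·_
  infixl 6 _:+ₚ_ _:-ₚ_

  _:+ₚ_ _:-ₚ_ : ∀ {m} → Poly² m → Poly² m → Poly² m
  (x , y) :+ₚ (x′ , y′) = x :+ x′ , y :+ y′
  (x , y) :-ₚ (x′ , y′) = x :- x′ , y :- y′

  _:·_ : ∀ {m} → Polynomial m → Poly² m → Poly² m
  t :· (x , y) = t :* x , t :* y

  :det : ∀ {m} → Poly² m → Poly² m → Polynomial m
  :det (x , y) (x′ , y′) = x :* y′ :- y :* x′

  :orient : ∀ {m} → Polynomial m → Poly² m → Poly² m → Poly² m → Polynomial m
  :orient σ p q r = σ :* :det (q :-ₚ p) (r :-ₚ p)

  orient-cong : ∀ σ o {p p′ q q′} → p ≈ₚ p′ → q ≈ₚ q′ → orient σ o p q ≈ orient σ o p′ q′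
  orient-cong σ o p≈p′ q≈q′ = *-congˡ (det-cong (-ₚ-congˡ o p≈p′) (-ₚ-congˡ o q≈q′))

  orient-swap : ∀ σ o p q → orient σ o q p ≈ - orient σ o p q
  orient-swap σ (o₁ , o₂) (p₁ , p₂) (q₁ , q₂) =
    solve 7 (λ σ o₁ o₂ p₁ p₂ q₁ q₂ → let o = o₁ , o₂; p = p₁ , p₂; q = q₁ , q₂ in
      :orient σ o q p := :- :orient σ o p q) refl σ o₁ o₂ p₁ p₂ q₁ q₂

  -- Makes `- σ` the right sign for views from B: a point to the left of AB lies to the right of BA.
  orient-neg : ∀ σ o p q → orient (- σ) o p q ≈ orient σ o q p
  orient-neg σ (o₁ , o₂) (p₁ , p₂) (q₁ , q₂) =
    solve 7 (λ σ o₁ o₂ p₁ p₂ q₁ q₂ → let o = o₁ , o₂; p = p₁ , p₂; q = q₁ , q₂ in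
      :orient (:- σ) o p q := :orient σ o q p) refl σ o₁ o₂ p₁ p₂ q₁ q₂

  orient-rotate : ∀ σ p q r → orient σ p q r ≈ orient σ q r p
  orient-rotate σ (o₁ , o₂) (p₁ , p₂) (q₁ , q₂) =
    solve 7 (λ σ o₁ o₂ p₁ p₂ q₁ q₂ → let o = o₁ , o₂; p = p₁ , p₂; q = q₁ , q₂ in
      :orient σ o p q := :orient σ p q o) refl σ o₁ o₂ p₁ p₂ q₁ q₂

  orient-scale : ∀ σ o p r t → orient σ o p (o +ₚ t · (r -ₚ o)) ≈ t * orient σ o p r
  orient-scale σ (o₁ , o₂) (p₁ , p₂) (r₁ , r₂) t =
    solve 8 (λ σ o₁ o₂ p₁ p₂ r₁ r₂ t → let o = o₁ , o₂; p = p₁ , p₂; r = r₁ , r₂ in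
      :orient σ o p (o :+ₚ t :· (r :-ₚ o)) := t :* :orient σ o p r)
      refl σ o₁ o₂ p₁ p₂ r₁ r₂ t

  -- Indices are totally ordered and `orient` is antisymmetric: for `l < k` or `k = l` a quantity
  -- and its negative would both be positive.
  orient-monotone⇒reflects : ∀ {n} σ o (f : Fin n → Point) →
    (∀ {k l} → k Fin.< l → 0# < orient σ o (f k) (f l)) →
    ∀ {k l} → 0# < orient σ o (f k) (f l) → k Fin.< l
  orient-monotone⇒reflects σ o f mono {k} {l} 0<kl with Fin.<-cmp k l
  ... | tri< k<l _ _    = k<l
  ... | tri≈ _ ≡.refl _ = ⊥-elim $ ¬0<x×0<-x 0<kl $
    <-respʳ (orient-swap σ o (f k) (f k)) 0<kl
  ... | tri> _ _ l<k    = ⊥-elim $ ¬0<x×0<-x 0<kl $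
    <-respʳ (orient-swap σ o (f k) (f l)) (mono l<k)

  -- Relative to `o`, `r` is `α` times `p` plus `β` times `r′`. In the determinant with `r′` the `β`
  -- term vanishes, leaving `α` times the determinant of `p` and `r′`; sliding along the rays only
  -- adds the factors `t` and `t′`.
  smallerAngle⇒orient : ∀ σ o p {r r′ v v′ t t′} → 0# < t → 0# < t′ →
    v ≈ₚ o +ₚ t · (r -ₚ o) → v′ ≈ₚ o +ₚ t′ · (r′ -ₚ o) →
    SmallerAngle p o r r′ → 0# < orient σ o p r′ → 0# < orient σ o v v′
  smallerAngle⇒orient σ o p {r} {r′} {v} {v′} {t} {t′} 0<t 0<t′ v≈ v′≈
    (α , β , 0<α , _ , r≈) 0<r′ = <-respʳ (sym eq) (*-pos 0<t (*-pos 0<t′ (*-pos 0<α 0<r′)))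
    where
    scale : ∀ σ o r r′ t t′ →
      orient σ o (o +ₚ t · (r -ₚ o)) (o +ₚ t′ · (r′ -ₚ o)) ≈ t * (t′ * orient σ o r r′)
    scale σ (o₁ , o₂) (r₁ , r₂) (s₁ , s₂) t t′ =
      solve 9 (λ σ o₁ o₂ r₁ r₂ s₁ s₂ t t′ → let o = o₁ , o₂; r = r₁ , r₂; r′ = s₁ , s₂ in
        :orient σ o (o :+ₚ t :· (r :-ₚ o)) (o :+ₚ t′ :· (r′ :-ₚ o))
          := t :* (t′ :* :orient σ o r r′)) refl σ o₁ o₂ r₁ r₂ s₁ s₂ t t′

    combine : ∀ σ x y α β → σ * det (α · x +ₚ β · y) y ≈ α * (σ * det x y)
    combine σ (x₁ , x₂) (y₁ , y₂) α β =
      solve 7 (λ σ x₁ x₂ y₁ y₂ α β → let x = x₁ , x₂; y = y₁ , y₂ in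
        σ :* :det (α :· x :+ₚ β :· y) y := α :* (σ :* :det x y)) refl σ x₁ x₂ y₁ y₂ α β

    eq : orient σ o v v′ ≈ t * (t′ * (α * orient σ o p r′))
    eq = begin
      orient σ o v v′                                             ≈⟨ orient-cong σ o v≈ v′≈ ⟩
      orient σ o (o +ₚ t · (r -ₚ o)) (o +ₚ t′ · (r′ -ₚ o))        ≈⟨ scale σ o r r′ t t′ ⟩
      t * (t′ * orient σ o r r′)
        ≈⟨ *-congˡ (*-congˡ (*-congˡ (det-cong r≈ ≈ₚ-refl))) ⟩
      t * (t′ * (σ * det (α · (p -ₚ o) +ₚ β · (r′ -ₚ o)) (r′ -ₚ o)))
        ≈⟨ *-congˡ (*-congˡ (combine σ (p -ₚ o) (r′ -ₚ o) α β)) ⟩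
      t * (t′ * (α * orient σ o p r′))                            ∎

  -- Intersecting a line through A with a line through B.

  -- Cramer's rule for the common point of the lines Aq and Bp.
  cramerˡ : ∀ σ A B p q {s t} → A +ₚ t · (q -ₚ A) ≈ₚ B +ₚ s · (p -ₚ B) →
    t * (σ * det (q -ₚ A) (p -ₚ B)) ≈ orient σ A B p
  cramerˡ σ A B p q {s} {t} meet = begin
    t * (σ * det (q -ₚ A) (p -ₚ B))                       ≈⟨ expand σ A B p q t ⟩
    σ * det ((A +ₚ t · (q -ₚ A)) -ₚ A) (p -ₚ B)
      -- Seen from A, the common point is also `(B - A) + s(p - B)`, whose second term is parallel
      -- to `p - B` and drops out of the determinant.
      ≈⟨ *-congˡ (det-cong (-ₚ-congˡ A meet) ≈ₚ-refl) ⟩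
    σ * det ((B +ₚ s · (p -ₚ B)) -ₚ A) (p -ₚ B)           ≈⟨ collect σ A B p s ⟩
    orient σ A B p                                        ∎
    where
    expand : ∀ σ A B p q t →
      t * (σ * det (q -ₚ A) (p -ₚ B)) ≈ σ * det ((A +ₚ t · (q -ₚ A)) -ₚ A) (p -ₚ B)
    expand σ (a₁ , a₂) (b₁ , b₂) (p₁ , p₂) (q₁ , q₂) t =
      solve 10 (λ σ a₁ a₂ b₁ b₂ p₁ p₂ q₁ q₂ t →
        let A = a₁ , a₂; B = b₁ , b₂; p = p₁ , p₂; q = q₁ , q₂ in
        t :* (σ :* :det (q :-ₚ A) (p :-ₚ B))
          := σ :* :det ((A :+ₚ t :· (q :-ₚ A)) :-ₚ A) (p :-ₚ B))
        refl σ a₁ a₂ b₁ b₂ p₁ p₂ q₁ q₂ t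

    collect : ∀ σ A B p s → σ * det ((B +ₚ s · (p -ₚ B)) -ₚ A) (p -ₚ B) ≈ orient σ A B p
    collect σ (a₁ , a₂) (b₁ , b₂) (p₁ , p₂) s =
      solve 8 (λ σ a₁ a₂ b₁ b₂ p₁ p₂ s →
        let A = a₁ , a₂; B = b₁ , b₂; p = p₁ , p₂ in
        σ :* :det ((B :+ₚ s :· (p :-ₚ B)) :-ₚ A) (p :-ₚ B) := :orient σ A B p)
        refl σ a₁ a₂ b₁ b₂ p₁ p₂ s

  -- This is `cramerˡ` with A and B, and `p` and `q`, exchanged; the exchange reverses orientation,
  -- hence `- σ`.
  cramerʳ : ∀ σ A B p q {s t} → A +ₚ t · (q -ₚ A) ≈ₚ B +ₚ s · (p -ₚ B) →
    s * (σ * det (q -ₚ A) (p -ₚ B)) ≈ orient σ A B q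
  cramerʳ σ A B p q {s} {t} meet = begin
    s * (σ * det (q -ₚ A) (p -ₚ B))                       ≈⟨ flip σ A B p q s ⟩
    s * (- σ * det (p -ₚ B) (q -ₚ A))                     ≈⟨ cramerˡ (- σ) B A q p (≈ₚ-sym meet) ⟩
    orient (- σ) B A q                                    ≈⟨ orient-neg σ B A q ⟩
    orient σ B q A                                        ≈⟨ orient-rotate σ A B q ⟨
    orient σ A B q                                        ∎
    where
    flip : ∀ σ A B p q s →
      s * (σ * det (q -ₚ A) (p -ₚ B)) ≈ s * (- σ * det (p -ₚ B) (q -ₚ A))
    flip σ (a₁ , a₂) (b₁ , b₂) (p₁ , p₂) (q₁ , q₂) s =
      solve 10 (λ σ a₁ a₂ b₁ b₂ p₁ p₂ q₁ q₂ s →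
        let A = a₁ , a₂; B = b₁ , b₂; p = p₁ , p₂; q = q₁ , q₂ in
        s :* (σ :* :det (q :-ₚ A) (p :-ₚ B)) := s :* (:- σ :* :det (p :-ₚ B) (q :-ₚ A)))
        refl σ a₁ a₂ b₁ b₂ p₁ p₂ q₁ q₂ s

  -- The parameters are only known to be non-negative; by Cramer's rule each
  -- divides a positive number, hence is apart from zero.
  onRays⇒positive : ∀ σ A B p q {v s t} → 0# < orient σ A B p → 0# < orient σ A B q →
    0# ≤ s → 0# ≤ t → v ≈ₚ A +ₚ t · (q -ₚ A) → v ≈ₚ B +ₚ s · (p -ₚ B) → 0# < s × 0# < t
  onRays⇒positive σ A B p q 0<p 0<q 0≤s 0≤t vA vB =
      positive 0≤s 0<q (cramerʳ σ A B p q meet)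
    , positive 0≤t 0<p (cramerˡ σ A B p q meet)
    where
    meet = ≈ₚ-trans (≈ₚ-sym vA) vB

    positive : ∀ {x y z} → 0# ≤ x → 0# < z → x * y ≈ z → 0# < x
    positive {x} {y} 0≤x 0<z xy≈z = 0≤x∧x#0⇒0<x 0≤x $ xy#0⇒y#0 y x $
      0<x⇒x#0 $ <-respʳ (trans (sym xy≈z) (*-comm x y)) 0<z

  -- At a common point the differences here and in `det-orientʳ` are `1 - t` and `1 - s` times the
  -- Cramer determinant, so they turn upper bounds on the parameters into angle comparisons at B and
  -- at A.
  det-orientˡ : ∀ σ A B p q →
    σ * det (q -ₚ A) (p -ₚ B) - orient σ A B p ≈ orient σ B q p
  det-orientˡ σ (a₁ , a₂) (b₁ , b₂) (p₁ , p₂) (q₁ , q₂) =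
    solve 9 (λ σ a₁ a₂ b₁ b₂ p₁ p₂ q₁ q₂ →
      let A = a₁ , a₂; B = b₁ , b₂; p = p₁ , p₂; q = q₁ , q₂ in
      σ :* :det (q :-ₚ A) (p :-ₚ B) :- :orient σ A B p := :orient σ B q p)
      refl σ a₁ a₂ b₁ b₂ p₁ p₂ q₁ q₂

  det-orientʳ : ∀ σ A B p q →
    σ * det (q -ₚ A) (p -ₚ B) - orient σ A B q ≈ orient σ A q p
  det-orientʳ σ (a₁ , a₂) (b₁ , b₂) (p₁ , p₂) (q₁ , q₂) =
    solve 9 (λ σ a₁ a₂ b₁ b₂ p₁ p₂ q₁ q₂ →
      let A = a₁ , a₂; B = b₁ , b₂; p = p₁ , p₂; q = q₁ , q₂ in
      σ :* :det (q :-ₚ A) (p :-ₚ B) :- :orient σ A B q := :orient σ A q p)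
      refl σ a₁ a₂ b₁ b₂ p₁ p₂ q₁ q₂

  -- Crossing criterion for the segments Bp and Aq.

  module _ σ A B p q (0<p : 0# < orient σ A B p) (0<q : 0# < orient σ A B q) where

    private
      Δ : Carrier
      Δ = σ * det (q -ₚ A) (p -ₚ B)

    -- `Δ` is positive because its product with the positive `t` is; multiplying it by the positive
    -- `1 - s` and `1 - t` gives the two orientations.
    segmentsMeet⇒orient : (∃[ z ] InteriorOfSegment B p z × InteriorOfSegment A q z) →
      0# < orient σ A q p × 0# < orient σ B q p
    segmentsMeet⇒orient (z , (s , 0<s , s<1 , zB) , (t , 0<t , t<1 , zA)) =
        <-respʳ (det-orientʳ σ A B p q) (difference s<1 sΔ)
      , <-respʳ (det-orientˡ σ A B p q) (difference t<1 tΔ)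
      where
      meet = ≈ₚ-trans (≈ₚ-sym zA) zB
      tΔ = cramerˡ σ A B p q meet
      sΔ = cramerʳ σ A B p q meet

      0<Δ : 0# < Δ
      0<Δ = 0<x*y⇒0<y 0<t (<-respʳ (sym tΔ) 0<p)

      difference : ∀ {x h} → x < 1# → x * Δ ≈ h → 0# < Δ - h
      difference {x} {h} x<1 xΔ≈h = <-respʳ
        (trans (solve 3 (λ u x y → (u :- x) :* y := u :* y :- x :* y) refl 1# x Δ)
          (+-cong (*-identityˡ Δ) (-‿cong xΔ≈h)))
        (*-pos (x<y⇒0<y-x x<1) 0<Δ)

    -- Cramer's rule read backwards: the parameters are defined as its quotients by `Δ`, and the two
    -- hypotheses bound them by 1.
    orient⇒segmentsMeet : 0# < orient σ A q p → 0# < orient σ B q p →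
      ∃[ z ] InteriorOfSegment B p z × InteriorOfSegment A q z
    orient⇒segmentsMeet 0<A 0<B =
        A +ₚ t · (q -ₚ A)
      , (s , *-pos 0<q 0<δ , fraction 0<Δ-q , meet)
      , (t , *-pos 0<p 0<δ , fraction 0<Δ-p , ≈ₚ-refl)
      where
      0<Δ-p : 0# < Δ - orient σ A B p
      0<Δ-p = <-respʳ (sym (det-orientˡ σ A B p q)) 0<B

      0<Δ-q : 0# < Δ - orient σ A B q
      0<Δ-q = <-respʳ (sym (det-orientʳ σ A B p q)) 0<A

      Δ⁻¹ : ∃[ δ ] 0# < δ × Δ * δ ≈ 1#
      -- `Δ` exceeds the positive `orient σ A B p`, so it is positive and can be inverted.
      Δ⁻¹ = 0<x⇒inverse (<-trans 0<p (0<y-x⇒x<y 0<Δ-p))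

      δ = proj₁ Δ⁻¹
      0<δ = proj₁ (proj₂ Δ⁻¹)
      Δδ≈1 = proj₂ (proj₂ Δ⁻¹)

      s t : Carrier
      s = orient σ A B q * δ
      t = orient σ A B p * δ

      fraction : ∀ {h} → 0# < Δ - h → h * δ < 1#
      fraction {h} 0<Δ-h = 0<y-x⇒x<y $ <-respʳ
        (trans (solve 3 (λ Δ h δ → (Δ :- h) :* δ := Δ :* δ :- h :* δ) refl Δ h δ)
          (+-congʳ Δδ≈1))
        (*-pos 0<Δ-h 0<δ)

      -- First coordinate of the linear dependence among the plane vectors `q - A`, `B - A` and
      -- `p - B`. With `δ` a free variable it is a polynomial identity; `Δ * δ ≈ 1#` enters only in
      -- `unit-step`.
      cramer₁ : ∀ σ A B p q δ →
        proj₁ (A +ₚ (orient σ A B p * δ) · (q -ₚ A)) ≈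
        proj₁ A + (σ * det (q -ₚ A) (p -ₚ B)) * δ * proj₁ (B -ₚ A)
          + orient σ A B q * δ * proj₁ (p -ₚ B)
      cramer₁ σ (a₁ , a₂) (b₁ , b₂) (p₁ , p₂) (q₁ , q₂) δ =
        solve 10 (λ σ a₁ a₂ b₁ b₂ p₁ p₂ q₁ q₂ δ →
          let A = a₁ , a₂; B = b₁ , b₂; p = p₁ , p₂; q = q₁ , q₂ in
          a₁ :+ :orient σ A B p :* δ :* (q₁ :- a₁)
            := a₁ :+ (σ :* :det (q :-ₚ A) (p :-ₚ B)) :* δ :* (b₁ :- a₁)
              :+ :orient σ A B q :* δ :* (p₁ :- b₁))
          refl σ a₁ a₂ b₁ b₂ p₁ p₂ q₁ q₂ δ

      cramer₂ : ∀ σ A B p q δ →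
        proj₂ (A +ₚ (orient σ A B p * δ) · (q -ₚ A)) ≈
        proj₂ A + (σ * det (q -ₚ A) (p -ₚ B)) * δ * proj₂ (B -ₚ A)
          + orient σ A B q * δ * proj₂ (p -ₚ B)
      cramer₂ σ (a₁ , a₂) (b₁ , b₂) (p₁ , p₂) (q₁ , q₂) δ =
        solve 10 (λ σ a₁ a₂ b₁ b₂ p₁ p₂ q₁ q₂ δ →
          let A = a₁ , a₂; B = b₁ , b₂; p = p₁ , p₂; q = q₁ , q₂ in
          a₂ :+ :orient σ A B p :* δ :* (q₂ :- a₂)
            := a₂ :+ (σ :* :det (q :-ₚ A) (p :-ₚ B)) :* δ :* (b₂ :- a₂)
              :+ :orient σ A B q :* δ :* (p₂ :- b₂))
          refl σ a₁ a₂ b₁ b₂ p₁ p₂ q₁ q₂ δ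

      unit-step : ∀ x y z → x + Δ * δ * (y - x) + z ≈ y + z
      unit-step x y z = begin
        x + Δ * δ * (y - x) + z  ≈⟨ +-congʳ (+-congˡ (*-congʳ Δδ≈1)) ⟩
        x + 1# * (y - x) + z     ≈⟨ +-congʳ (+-congˡ (*-identityˡ (y - x))) ⟩
        x + (y - x) + z          ≈⟨ solve 3 (λ x y z → x :+ (y :- x) :+ z := y :+ z) refl x y z ⟩
        y + z                    ∎

      meet : A +ₚ t · (q -ₚ A) ≈ₚ B +ₚ s · (p -ₚ B)
      meet = trans (cramer₁ σ A B p q δ) (unit-step _ _ _)
           , trans (cramer₂ σ A B p q δ) (unit-step _ _ _)

-- From ray angles to crossings in a realization.

module RealizationProperties {c ℓ₁ ℓ₂} {F : OrderedField c ℓ₁ ℓ₂} {n} {π : Permutation′ n}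
  (K : Plane.Realization F π) where
  open OrderedField F
  open OrderedFieldProperties F
  open Plane F
  open PlaneProperties F
  open Realization K

  module _ (σ : Carrier)
    (sided : ∀ k → 0# < orient σ A B (rayA k) × 0# < orient σ A B (rayB k)) where

    -- Lists the vertices by angular rank at `a`, while `vertexB` lists them by label, which is the
    -- rank at `b`.
    vertexA : Fin n → Point
    vertexA k = position ⟨ π ⟨$⟩ʳ k ⟩

    vertexB : Fin n → Point
    vertexB k = position ⟨ k ⟩

    vertexA-inverse : ∀ i → vertexA (π ⟨$⟩ˡ i) ≡ vertexB i
    vertexA-inverse i = ≡.cong vertexB (inverseʳ π)

    -- The construction only gives a non-negative parameter. It is positive because the vertex also
    -- lies on a ray from B and both rays point strictly to the same side of AB.
    rayParameterA : ∀ k → ∃[ t ] 0# < t × vertexA k ≈ₚ A +ₚ t · (rayA k -ₚ A)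
    rayParameterA k =
      let (t , 0≤t , vA) = vertexOnRayA k
          (s , 0≤s , vB) = vertexOnRayB (π ⟨$⟩ʳ k)
      in t , proj₂ (onRays⇒positive σ A B (rayB (π ⟨$⟩ʳ k)) (rayA k)
                     (proj₂ (sided (π ⟨$⟩ʳ k))) (proj₁ (sided k)) 0≤s 0≤t vA vB) , vA

    rayParameterB : ∀ k → ∃[ s ] 0# < s × vertexB k ≈ₚ B +ₚ s · (rayB k -ₚ B)
    rayParameterB k =
      let l = π ⟨$⟩ˡ k
          (t , 0≤t , vA) = vertexOnRayA l
          (s , 0≤s , vB) = vertexOnRayB k
          vA′ = ≡.subst (λ v → v ≈ₚ A +ₚ t · (rayA l -ₚ A)) (vertexA-inverse k) vA
      in s , proj₁ (onRays⇒positive σ A B (rayB k) (rayA l)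
                     (proj₂ (sided k)) (proj₁ (sided l)) 0≤s 0≤t vA′ vB) , vB

    0<orient-vertex : ∀ k → 0# < orient σ A B (vertexB k)
    0<orient-vertex k = ≡.subst (λ v → 0# < orient σ A B v) (vertexA-inverse k) $
      let l = π ⟨$⟩ˡ k
          (t , 0<t , vA) = rayParameterA l
      in <-respʳ (sym (trans (orient-cong σ A ≈ₚ-refl vA) (orient-scale σ A B (rayA l) t)))
           (*-pos 0<t (proj₁ (sided l)))

    increasing-vertexA : ∀ {k l} → k Fin.< l → 0# < orient σ A (vertexA k) (vertexA l)
    increasing-vertexA {k} {l} k<l =
      let (_ , 0<t , v) = rayParameterA k; (_ , 0<t′ , v′) = rayParameterA l
      in smallerAngle⇒orient σ A B 0<t 0<t′ v v′ (increasingA k<l) (proj₁ (sided l))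

    -- Angles at `b` are measured from the segment `ba`, and with respect to BA the rays lie on the
    -- opposite side, hence `- σ`.
    increasing-vertexB : ∀ {k l} → k Fin.< l → 0# < orient (- σ) B (vertexB k) (vertexB l)
    increasing-vertexB {k} {l} k<l =
      let (_ , 0<s , v) = rayParameterB k; (_ , 0<s′ , v′) = rayParameterB l
      in smallerAngle⇒orient (- σ) B A 0<s 0<s′ v v′ (increasingB k<l) $
           <-respʳ (trans (orient-rotate σ A B (rayB l)) (sym (orient-neg σ B A (rayB l))))
             (proj₂ (sided l))

    crosses⇔inversion : ∀ i j → Crosses (edge-b i) (edge-a j) ⇔ (i , j) ∈ E π
    crosses⇔inversion i j = mk⇔ to from
      where
      to : Crosses (edge-b i) (edge-a j) → (i , j) ∈ E π
      to crossing =
        let (0<A , 0<B) = segmentsMeet⇒orient σ A B (vertexB i) (vertexB j)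
                            (0<orient-vertex i) (0<orient-vertex j) crossing in
          -- The orientation at B orders the labels as `i < j`; the one at A orders the ranks,
          -- placing that of `j` before that of `i`. Equal `i` and `j` are excluded here as well.
          orient-monotone⇒reflects (- σ) B vertexB increasing-vertexB
            (<-respʳ (sym (orient-neg σ B (vertexB i) (vertexB j))) 0<B)
        , orient-monotone⇒reflects σ A vertexA increasing-vertexA
            (≡.subst₂ (λ v w → 0# < orient σ A v w)
              (≡.sym (vertexA-inverse j)) (≡.sym (vertexA-inverse i)) 0<A)

      from : (i , j) ∈ E π → Crosses (edge-b i) (edge-a j)
      from (i<j , j<i) =
        orient⇒segmentsMeet σ A B (vertexB i) (vertexB j) (0<orient-vertex i) (0<orient-vertex j)
          (≡.subst₂ (λ v w → 0# < orient σ A v w)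
            (vertexA-inverse j) (vertexA-inverse i) (increasing-vertexA j<i))
          (<-respʳ (orient-neg σ B (vertexB i) (vertexB j)) (increasing-vertexB i<j))

  -- The sign absorbs the choice of side, so one argument serves for rays on the left and on the
  -- right of AB.
  orientation : ∃[ σ ] (∀ k → 0# < orient σ A B (rayA k) × 0# < orient σ A B (rayB k))
  orientation with sameSide
  ... | inj₁ left  = 1# , λ k →
    let (0<A , 0<B) = left k in <-respʳ (sym (*-identityˡ _)) 0<A , <-respʳ (sym (*-identityˡ _)) 0<B
  ... | inj₂ right = - 1# , λ k →
    let (A<0 , B<0) = right k in negated A<0 , negated B<0
    where
    negated : ∀ {x} → x < 0# → 0# < - 1# * x
    negated {x} x<0 = <-respʳ (sym (-1*x≈-x x)) (x<0⇒0<-x x<0)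

theorem1 : ∀ {c ℓ₁ ℓ₂ : Level} (F : OrderedField c ℓ₁ ℓ₂) (n : ℕ) (π : Permutation′ n)
    (K : Plane.Realization F π) (i j : Fin n) →
    Plane.Realization.Crosses K (edge-b i) (edge-a j) ⇔ ((i , j) ∈ E π)
theorem1 F n π K = crosses⇔inversion σ sided
  where
  open RealizationProperties K
  σ = proj₁ orientation
  sided = proj₂ orientation
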